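{- For every integer $r\ge1$ and every $n\ge0$, $$B^{(r)}_{n,q}(x)=\sum_{k=0}^{n}\binom{n}{k}_q\left(\int_0^1B^{(r)}_{n-k,q}(y)\,d_qy\right)B_{k,q}(x)=\sum_{k=0}^{n}\binom{n}{k}_qB^{(r-1)}_{n-k,q}\,B_{k,q}(x);$$ in particular $\int_0^1B^{(r)}_{m,q}(y)\,d_qy=B^{(r-1)}_{m,q}$ for all $m\ge0$.
   Context: Fix $q$ with $0<q<1$. For an integer $n\geq 0$ let $[n]_q=\frac{1-q^n}{1-q}$, $[n]_q!=[n]_q[n-1]_q\cdots[1]_q$ (with $[0]_q!=1$), and for $0\le l\le n$ let $\binom{n}{l}_q=\frac{[n]_q!}{[l]_q!\,[n-l]_q!}$. Let $e_q(t)=\sum_{n\ge0}\frac{t^n}{[n]_q!}$ (a formal power series). The $q$-Bernoulli polynomials $B_{n,q}(x)$ are defined by $\frac{t}{e_q(t)-1}e_q(xt)=\sum_{n\ge0}B_{n,q}(x)\frac{t^n}{[n]_q!}$. For an integer $r\ge0$, the $q$-Bernoulli polynomials of order $r$ are defined by $\left(\frac{t}{e_q(t)-1}\right)^{r}e_q(xt)=\sum_{n\ge0}B^{(r)}_{n,q}(x)\frac{t^n}{[n]_q!}$, with $B^{(r)}_{n,q}=B^{(r)}_{n,q}(0)$ (so $B^{(0)}_{n,q}=\delta_{n,0}$ and $B^{(1)}_{n,q}(x)=B_{n,q}(x)$). The Jackson $q$-integral is $\int_0^1 f(y)\,d_qy=(1-q)\sum_{a=0}^{\infty}f(q^a)q^a$.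 -}

module Defs where

open import Level using (Level; _⊔_) renaming (suc to lsuc)
open import Data.Nat.Base as ℕ using (ℕ; zero; suc; _∸_)
open import Data.Fin.Base using (Fin; toℕ; zero; suc)
open import Data.Product.Base using (Σ-syntax; ∃-syntax; _×_; _,_; proj₁; proj₂)
open import Data.Sum.Base using (_⊎_)
open import Data.Vec.Base using (Vec; []; _∷_; head; lookup)
open import Relation.Binary.Core using (Rel)
open import Relation.Binary.Structures using (IsStrictPartialOrder)
open import Relation.Binary.PropositionalEquality.Core as ≡ using (_≡_)
open import Algebra.Bundles using (CommutativeRing; Semiring; RawSemiring)
open import Algebra.Apartness.Bundles using (HeytingField; HeytingCommutativeRing)
import Algebra.Apartness.Properties.HeytingCommutativeRing as HCRProperties
import Algebra.Definitions.RawSemiring as RawSemiringDefs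
import Algebra.Properties.Ring as RingProperties
import Algebra.Properties.Semiring.Sum as SemiringSum
import Relation.Binary.Reasoning.Setoid as ≈-Reasoning

-- The real numbers, axiomatised as a Cauchy-complete Archimedean ordered
-- field.  Classically these axioms determine ℝ up to isomorphism; they are
-- phrased with apartness and strict order so that the constructive Cauchy
-- (Bishop) reals satisfy them too.  Neither excluded middle nor decidability
-- of the order is assumed.
record RealNumbers (c ℓ₁ ℓ₂ : Level) : Set (lsuc (c ⊔ ℓ₁ ⊔ ℓ₂)) where
  infix 4 _<_
  field
    heytingField : HeytingField c ℓ₁ ℓ₂

  open HeytingField heytingField public

  commutativeRing : CommutativeRing c ℓ₁
  commutativeRing = HeytingCommutativeRing.commutativeRing heytingCommutativeRing

  open CommutativeRing commutativeRing public
    using (ring; semiring)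
  open RawSemiringDefs (Semiring.rawSemiring semiring) public
    using (_^_) renaming (_×_ to _·_)
  open SemiringSum semiring public
    using (sum; sum-syntax; sum⁺-syntax)

  field
    _<_                  : Rel Carrier ℓ₂
    isStrictPartialOrder : IsStrictPartialOrder _≈_ _<_
    #⇒<∨>                : ∀ {x y} → x # y → x < y ⊎ y < x
    <⇒#                  : ∀ {x y} → x < y → x # y
    +-monoˡ-<            : ∀ {x y} z → x < y → x + z < y + z
    *-pos                : ∀ {x y} → 0# < x → 0# < y → 0# < x * y
    archimedean          : ∀ x → ∃[ n ] x < n · 1#

  -- |x − y| < ε, with the absolute value unfolded.
  Within : Carrier → Carrier → Carrier → Set ℓ₂
  Within ε x y = (- ε < x - y) × (x - y < ε)

  IsCauchy : (ℕ → Carrier) → Set (c ⊔ ℓ₂)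
  IsCauchy s = ∀ ε → 0# < ε →
    ∃[ N ] ∀ m n → N ℕ.≤ m → N ℕ.≤ n → Within ε (s m) (s n)

  infix 4 _⟶_
  _⟶_ : (ℕ → Carrier) → Carrier → Set (c ⊔ ℓ₂)
  s ⟶ L = ∀ ε → 0# < ε → ∃[ N ] ∀ n → N ℕ.≤ n → Within ε (s n) L

  field
    complete : ∀ s → IsCauchy s → ∃[ L ] s ⟶ L

  module < = IsStrictPartialOrder isStrictPartialOrder

  Summable : (ℕ → Carrier) → Set (c ⊔ ℓ₂)
  Summable u = ∃[ S ] (λ N → ∑[ a < N ] u (toℕ a)) ⟶ S

  ∑∞ : (u : ℕ → Carrier) → Summable u → Carrier
  ∑∞ u = proj₁

  open HCRProperties heytingCommutativeRing public
    using (x-0≈x; 1#0; x#0y#0→xy#0; #-congʳ; #-congˡ; invertibleˡ⇒#)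

  infix 9 _⁻¹[_]
  _⁻¹[_] : (x : Carrier) → x # 0# → Carrier
  x ⁻¹[ x#0 ] = proj₁ (#⇒invertible x#0)

  ⁻¹-inverseˡ : ∀ x (x#0 : x # 0#) → x ⁻¹[ x#0 ] * x ≈ 1#
  ⁻¹-inverseˡ x x#0 =
    trans (*-congˡ (sym (x-0≈x x))) (proj₁ (proj₂ (#⇒invertible x#0)))

  ⁻¹-inverseʳ : ∀ x (x#0 : x # 0#) → x * x ⁻¹[ x#0 ] ≈ 1#
  ⁻¹-inverseʳ x x#0 = trans (*-comm _ _) (⁻¹-inverseˡ x x#0)

  ⁻¹#0 : ∀ x (x#0 : x # 0#) → x ⁻¹[ x#0 ] # 0#
  ⁻¹#0 x x#0 = invertibleˡ⇒#
    (x , trans (*-congˡ (x-0≈x _)) (⁻¹-inverseʳ x x#0))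

  1⁻¹≈1 : ∀ x (x#0 : x # 0#) → x ≈ 1# → x ⁻¹[ x#0 ] ≈ 1#
  1⁻¹≈1 x x#0 x≈1 =
    trans (sym (*-identityʳ _)) (trans (*-congˡ (sym x≈1)) (⁻¹-inverseˡ x x#0))

  x#y⇒x-y#0 : ∀ {x y} → x # y → x - y # 0#
  x#y⇒x-y#0 x#y with #⇒invertible x#y
  ... | z , z*[x-y]≈1 , _ = invertibleˡ⇒# (z , trans (*-congˡ (x-0≈x _)) z*[x-y]≈1)

  x<y⇒0<y-x : ∀ {x y} → x < y → 0# < y - x
  x<y⇒0<y-x {x} {y} x<y = <.<-respˡ-≈ (-‿inverseʳ x) (+-monoˡ-< (- x) x<y)

  *-monoˡ-< : ∀ {x y z} → 0# < z → x < y → z * x < z * y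
  *-monoˡ-< {x} {y} {z} 0<z x<y =
    <.<-respʳ-≈ eq (<.<-respˡ-≈ (+-identityˡ _)
      (+-monoˡ-< (z * x) (*-pos 0<z (x<y⇒0<y-x x<y))))
    where
    open ≈-Reasoning setoid
    eq : z * (y - x) + z * x ≈ z * y
    eq = begin
      z * (y - x) + z * x   ≈⟨ distribˡ z (y - x) x ⟨
      z * (y - x + x)       ≈⟨ *-congˡ (+-assoc y (- x) x) ⟩
      z * (y + (- x + x))   ≈⟨ *-congˡ (+-congˡ (-‿inverseˡ x)) ⟩
      z * (y + 0#)          ≈⟨ *-congˡ (+-identityʳ y) ⟩
      z * y                 ∎

-- Formal power series in one variable t, given by their coefficients.
module PowerSeries {c ℓ₁ ℓ₂} (ℝ : RealNumbers c ℓ₁ ℓ₂) where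
  open RealNumbers ℝ
  open RingProperties ring using (-‿distribʳ-*)

  FPS : Set c
  FPS = ℕ → Carrier

  infix 4 _≋_
  _≋_ : FPS → FPS → Set ℓ₁
  f ≋ g = ∀ n → f n ≈ g n

  0ₛ 1ₛ t : FPS
  0ₛ n = 0#
  1ₛ zero    = 1#
  1ₛ (suc n) = 0#
  t zero    = 0#
  t (suc n) = 1ₛ n

  infixl 6 _⊕_ _⊖_
  infixl 7 _⊛_
  _⊕_ _⊖_ _⊛_ : FPS → FPS → FPS
  (f ⊕ g) n = f n + g n
  (f ⊖ g) n = f n - g n
  (f ⊛ g) n = ∑[ i ≤ n ] (f (toℕ i) * g (n ∸ toℕ i))

  fpsRawSemiring : RawSemiring c ℓ₁
  fpsRawSemiring = record
    { Carrier = FPS ; _≈_ = _≋_ ; _+_ = _⊕_ ; _*_ = _⊛_ ; 0# = 0ₛ ; 1# = 1ₛ }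

  open RawSemiringDefs fpsRawSemiring public using () renaming (_^_ to _^ₛ_)

  -- The substitution f(t) ↦ f(xt).
  _⟦_t⟧ : FPS → Carrier → FPS
  (f ⟦ x t⟧) n = f n * x ^ n

  -- (f(t) − f(0)) / t
  shift : FPS → FPS
  shift f n = f (suc n)

  -- The coefficients g n, …, g 0 (in this order) of the reciprocal g of f,
  -- from  f 0 * g (n + 1) = − ∑_{i ≤ n} f (i + 1) * g (n − i).
  recips : (f : FPS) → f 0 # 0# → (n : ℕ) → Vec Carrier (suc n)
  recips f f₀#0 zero    = f 0 ⁻¹[ f₀#0 ] ∷ []
  recips f f₀#0 (suc n) =
    - (f 0 ⁻¹[ f₀#0 ] * ∑[ i ≤ n ] (f (suc (toℕ i)) * lookup (recips f f₀#0 n) i))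
    ∷ recips f f₀#0 n

  recip : (f : FPS) → f 0 # 0# → FPS
  recip f f₀#0 n = head (recips f f₀#0 n)

  lookup-recips : ∀ f (f₀#0 : f 0 # 0#) n (i : Fin (suc n)) →
                  lookup (recips f f₀#0 n) i ≡ recip f f₀#0 (n ∸ toℕ i)
  lookup-recips f f₀#0 zero    zero    = ≡.refl
  lookup-recips f f₀#0 (suc n) zero    = ≡.refl
  lookup-recips f f₀#0 (suc n) (suc i) = lookup-recips f f₀#0 n i

  recip-inverse : ∀ f (f₀#0 : f 0 # 0#) → f ⊛ recip f f₀#0 ≋ 1ₛ
  recip-inverse f f₀#0 zero    = trans (+-identityʳ _) (⁻¹-inverseʳ _ f₀#0)
  recip-inverse f f₀#0 (suc n) = begin
    f 0 * - (f₀⁻¹ * S) + S′    ≈⟨ +-cong (-‿distribʳ-* _ _) S≈S′ ⟨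
    - (f 0 * (f₀⁻¹ * S)) + S   ≈⟨ +-congʳ (-‿cong (*-assoc _ _ _)) ⟨
    - (f 0 * f₀⁻¹ * S) + S     ≈⟨ +-congʳ (-‿cong (*-congʳ (⁻¹-inverseʳ _ f₀#0))) ⟩
    - (1# * S) + S             ≈⟨ +-congʳ (-‿cong (*-identityˡ S)) ⟩
    - S + S                    ≈⟨ -‿inverseˡ S ⟩
    0#                         ∎
    where
    open ≈-Reasoning setoid
    f₀⁻¹ = f 0 ⁻¹[ f₀#0 ]
    S  = ∑[ i ≤ n ] (f (suc (toℕ i)) * lookup (recips f f₀#0 n) i)
    S′ = ∑[ i ≤ n ] (f (suc (toℕ i)) * recip f f₀#0 (n ∸ toℕ i))
    S≈S′ : S ≈ S′
    S≈S′ = SemiringSum.sum-cong-≋ semiring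
      (λ i → *-congˡ {f (suc (toℕ i))} (reflexive (lookup-recips f f₀#0 n i)))

module QBernoulli {c ℓ₁ ℓ₂} (ℝ : RealNumbers c ℓ₁ ℓ₂)
  (q : RealNumbers.Carrier ℝ)
  (0<q : RealNumbers._<_ ℝ (RealNumbers.0# ℝ) q)
  (q<1 : RealNumbers._<_ ℝ q (RealNumbers.1# ℝ)) where
  open RealNumbers ℝ
  open PowerSeries ℝ

  1-q#0 : 1# - q # 0#
  1-q#0 = x#y⇒x-y#0 (#-sym (<⇒# q<1))

  q^[1+n]<1 : ∀ n → q ^ suc n < 1#
  q^[1+n]<1 zero    = <.<-respˡ-≈ (sym (*-identityʳ q)) q<1
  q^[1+n]<1 (suc n) =
    <.trans (<.<-respʳ-≈ (*-identityʳ q) (*-monoˡ-< 0<q (q^[1+n]<1 n))) q<1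

  [_]q : ℕ → Carrier
  [ n ]q = (1# - q ^ n) * (1# - q) ⁻¹[ 1-q#0 ]

  [1+n]q#0 : ∀ n → [ suc n ]q # 0#
  [1+n]q#0 n = x#0y#0→xy#0 (x#y⇒x-y#0 (#-sym (<⇒# (q^[1+n]<1 n)))) (⁻¹#0 _ 1-q#0)

  [_]q! : ℕ → Carrier
  [ zero ]q!  = 1#
  [ suc n ]q! = [ suc n ]q * [ n ]q!

  [n]q!#0 : ∀ n → [ n ]q! # 0#
  [n]q!#0 zero    = 1#0
  [n]q!#0 (suc n) = x#0y#0→xy#0 ([1+n]q#0 n) ([n]q!#0 n)

  -- Meaningful for l ≤ n only.
  binom : ℕ → ℕ → Carrier
  binom n l = [ n ]q! * ([ l ]q! * [ n ∸ l ]q!) ⁻¹[ x#0y#0→xy#0 ([n]q!#0 l) ([n]q!#0 (n ∸ l)) ]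

  expq : FPS
  expq n = [ n ]q! ⁻¹[ [n]q!#0 n ]

  shift[expq-1]₀#0 : shift (expq ⊖ 1ₛ) 0 # 0#
  shift[expq-1]₀#0 = #-congʳ (sym (x-0≈x _)) (⁻¹#0 _ ([n]q!#0 1))

  -- Since e_q(t) − 1 has no constant term, t/(e_q(t) − 1) is the reciprocal
  -- of (e_q(t) − 1)/t.
  t/[expq-1] : FPS
  t/[expq-1] = recip (shift (expq ⊖ 1ₛ)) shift[expq-1]₀#0

  t/[expq-1]-correct : (expq ⊖ 1ₛ) ⊛ t/[expq-1] ≋ t
  t/[expq-1]-correct n = helper n
    where
    expq₀-1≈0 : (expq ⊖ 1ₛ) 0 ≈ 0#
    expq₀-1≈0 = trans (+-congʳ (1⁻¹≈1 1# ([n]q!#0 0) refl)) (-‿inverseʳ 1#)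
    helper : (expq ⊖ 1ₛ) ⊛ t/[expq-1] ≋ t
    helper zero    = trans (+-identityʳ _) (trans (*-congʳ expq₀-1≈0) (zeroˡ _))
    helper (suc n) = trans
      (+-cong (trans (*-congʳ expq₀-1≈0) (zeroˡ _)) (recip-inverse _ shift[expq-1]₀#0 n))
      (+-identityˡ _)

  -- The sequence a with  f(t) = ∑ₙ a n · tⁿ/[n]q!
  qExpCoeff : FPS → ℕ → Carrier
  qExpCoeff f n = [ n ]q! * f n

  qExpCoeff-correct : ∀ f n → qExpCoeff f n * [ n ]q! ⁻¹[ [n]q!#0 n ] ≈ f n
  qExpCoeff-correct f n = trans (*-comm _ _) (trans (sym (*-assoc _ _ _))
    (trans (*-congʳ (⁻¹-inverseˡ _ ([n]q!#0 n))) (*-identityˡ _)))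

  B : ℕ → Carrier → Carrier
  B n x = qExpCoeff (t/[expq-1] ⊛ expq ⟦ x t⟧) n

  B⟨_⟩ : ℕ → ℕ → Carrier → Carrier
  B⟨ r ⟩ n x = qExpCoeff (t/[expq-1] ^ₛ r ⊛ expq ⟦ x t⟧) n

  JacksonIntegrable : (Carrier → Carrier) → Set (c ⊔ ℓ₂)
  JacksonIntegrable f = Summable (λ a → f (q ^ a) * q ^ a)

  ∫₀¹ : (f : Carrier → Carrier) → JacksonIntegrable f → Carrier
  ∫₀¹ f f-int = (1# - q) * ∑∞ (λ a → f (q ^ a) * q ^ a) f-int

module Submission where

open import Defs
open import Data.Nat.Base as ℕ using (ℕ; zero; suc; _∸_)
import Data.Nat.Properties as ℕ
open import Data.Fin.Base using (Fin; toℕ; zero; suc)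
open import Data.Product.Base using (_×_; _,_; ∃-syntax; proj₁; proj₂)
open import Data.Sum.Base using (inj₁; inj₂)
open import Function.Base using (_∘_)
open import Level using (_⊔_)
open import Relation.Nullary.Negation using (¬_)
open import Relation.Binary.PropositionalEquality.Core as ≡ using (_≡_)
open import Algebra.Bundles using (CommutativeRing)
import Algebra.Properties.Ring as RingProperties
import Algebra.Properties.CommutativeSemiring.Exp as ExpProperties
import Algebra.Properties.Semiring.Mult as MultProperties
import Algebra.Properties.Semiring.Sum as SumProperties
import Algebra.Solver.Ring.NaturalCoefficients.Default as SemiringSolver
import Relation.Binary.Reasoning.Setoid as ≈-Reasoning

-- Write T = t/(e_q(t) − 1).  Jackson integration of the monomial yᵏ gives 1/[k+1]_q, so integrating
-- the coefficients of T^r e_q(yt) replaces e_q(yt) by (e_q(t) − 1)/t, the reciprocal of T; what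
-- remains is T^(r−1), the generating series of the numbers B⟨ r ∸ 1 ⟩.  The expansions then compare
-- coefficients in T^r e_q(xt) = T e_q(xt) · T^(r−1).
--
-- A partial sum of a Jackson integral of a polynomial differs from its limit by qᴺ times a bounded
-- remainder, and qᴺ → 0 follows from Bernoulli's inequality and the Archimedean axiom.

-- Ring laws of the Cauchy product of formal power series.

module PowerSeriesProperties {c ℓ₁ ℓ₂} (ℝ : RealNumbers c ℓ₁ ℓ₂) where
  open RealNumbers ℝ
  open PowerSeries ℝ
  open SumProperties semiring using (sum-cong-≋; sum-replicate-zero; ∑-distrib-+; *-distribˡ-sum)
  open SemiringSolver (CommutativeRing.commutativeSemiring commutativeRing)
    using (solve; con; _:+_; _:*_; _:=_)
  open ≈-Reasoning setoid

  ⊛-cong : ∀ {f f′ g g′} → f ≋ f′ → g ≋ g′ → f ⊛ g ≋ f′ ⊛ g′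
  ⊛-cong f≋f′ g≋g′ n =
    sum-cong-≋ {suc n} λ i → *-cong (f≋f′ (toℕ i)) (g≋g′ (n ∸ toℕ i))

  ⊛-congʳ : ∀ {f f′} g → f ≋ f′ → f ⊛ g ≋ f′ ⊛ g
  ⊛-congʳ g f≋f′ = ⊛-cong f≋f′ λ _ → refl

  ⊛-congˡ : ∀ f {g g′} → g ≋ g′ → f ⊛ g ≋ f ⊛ g′
  ⊛-congˡ f = ⊛-cong {f} λ _ → refl

  -- The Cauchy product unfolds definitionally at its first summand, splitting off `f 0`. This is
  -- the mirror recursion at the last summand; the two together yield commutativity by induction,
  -- with no reindexing of sums.
  ⊛-sucʳ : ∀ f g n → (f ⊛ g) (suc n) ≈ g 0 * f (suc n) + (f ⊛ shift g) n
  ⊛-sucʳ f g zero = solve 3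
    (λ u v w → u :+ (v :* w :+ con 0) := w :* v :+ (u :+ con 0))
    refl (f 0 * g 1) (f 1) (g 0)
  ⊛-sucʳ f g (suc n) = begin
    f 0 * g (2 ℕ.+ n) + (shift f ⊛ g) (suc n)
      ≈⟨ +-congˡ (⊛-sucʳ (shift f) g n) ⟩
    f 0 * g (2 ℕ.+ n) + (g 0 * f (2 ℕ.+ n) + (shift f ⊛ shift g) n)
      ≈⟨ solve 3 (λ a b c → a :+ (b :+ c) := b :+ (a :+ c)) refl
           (f 0 * g (2 ℕ.+ n)) (g 0 * f (2 ℕ.+ n)) ((shift f ⊛ shift g) n) ⟩
    g 0 * f (2 ℕ.+ n) + (f ⊛ shift g) (suc n)  ∎

  ⊛-comm : ∀ f g → f ⊛ g ≋ g ⊛ f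
  ⊛-comm f g zero    = +-congʳ (*-comm (f 0) (g 0))
  ⊛-comm f g (suc n) = begin
    f 0 * g (suc n) + (shift f ⊛ g) n  ≈⟨ +-congˡ (⊛-comm (shift f) g n) ⟩
    f 0 * g (suc n) + (g ⊛ shift f) n  ≈⟨ ⊛-sucʳ g f n ⟨
    (g ⊛ f) (suc n)                    ∎

  ⊛-distribʳ-⊕ : ∀ h f g → (f ⊕ g) ⊛ h ≋ f ⊛ h ⊕ g ⊛ h
  ⊛-distribʳ-⊕ h f g n = trans
    (sum-cong-≋ {suc n} λ i → distribʳ (h (n ∸ toℕ i)) (f (toℕ i)) (g (toℕ i)))
    (∑-distrib-+ {suc n}
      (λ i → f (toℕ i) * h (n ∸ toℕ i)) (λ i → g (toℕ i) * h (n ∸ toℕ i)))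

  ⊛-scaleˡ : ∀ a f g n → ((λ i → a * f i) ⊛ g) n ≈ a * (f ⊛ g) n
  ⊛-scaleˡ a f g n = trans
    (sum-cong-≋ {suc n} λ i → *-assoc a (f (toℕ i)) (g (n ∸ toℕ i)))
    (sym (*-distribˡ-sum {suc n} a (λ i → f (toℕ i) * g (n ∸ toℕ i))))

  -- Induction on the index with `f` varying: `shift (f ⊛ g)` is definitionally `f 0` times
  -- `shift g`, plus `shift f ⊛ g`.
  ⊛-assoc : ∀ f g h → (f ⊛ g) ⊛ h ≋ f ⊛ (g ⊛ h)
  ⊛-assoc f g h zero = solve 3
    (λ a b c → (a :* b :+ con 0) :* c :+ con 0 := a :* (b :* c :+ con 0) :+ con 0)
    refl (f 0) (g 0) (h 0)
  ⊛-assoc f g h (suc n) = begin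
    ((f ⊛ g) ⊛ h) (suc n)
      ≈⟨ +-congˡ (⊛-distribʳ-⊕ h (λ i → f 0 * shift g i) (shift f ⊛ g) n) ⟩
    (f 0 * g 0 + 0#) * h (suc n) + (((λ i → f 0 * shift g i) ⊛ h) n + ((shift f ⊛ g) ⊛ h) n)
      ≈⟨ +-congˡ (+-cong (⊛-scaleˡ (f 0) (shift g) h n) (⊛-assoc (shift f) g h n)) ⟩
    (f 0 * g 0 + 0#) * h (suc n) + (f 0 * (shift g ⊛ h) n + (shift f ⊛ (g ⊛ h)) n)
      ≈⟨ solve 5
           (λ a b c d e → (a :* b :+ con 0) :* c :+ (a :* d :+ e) := a :* (b :* c :+ d) :+ e)
           refl (f 0) (g 0) (h (suc n)) ((shift g ⊛ h) n) ((shift f ⊛ (g ⊛ h)) n) ⟩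
    (f ⊛ (g ⊛ h)) (suc n)  ∎

  ⊛-zeroˡ : ∀ f → 0ₛ ⊛ f ≋ 0ₛ
  ⊛-zeroˡ f n = trans
    (sum-cong-≋ {suc n} λ i → zeroˡ (f (n ∸ toℕ i))) (sum-replicate-zero (suc n))

  ⊛-identityˡ : ∀ f → 1ₛ ⊛ f ≋ f
  ⊛-identityˡ f zero    = trans (+-identityʳ _) (*-identityˡ (f 0))
  ⊛-identityˡ f (suc n) = trans
    (+-cong (*-identityˡ (f (suc n))) (⊛-zeroˡ f n)) (+-identityʳ _)

  ⊛-identityʳ : ∀ f → f ⊛ 1ₛ ≋ f
  ⊛-identityʳ f n = trans (⊛-comm f 1ₛ n) (⊛-identityˡ f n)

-- Ordered-field consequences: positivity, uniqueness of limits, bounds.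

module OrderProperties {c ℓ₁ ℓ₂} (ℝ : RealNumbers c ℓ₁ ℓ₂) where
  open RealNumbers ℝ
  open RingProperties ring
    using (-‿involutive; -0#≈0#; -‿distribˡ-*; -‿distribʳ-*; -‿+-comm; ⁻¹-anti-homo‿-)

  x+y<x+z : ∀ x {y z} → y < z → x + y < x + z
  x+y<x+z x y<z = <.<-respˡ-≈ (+-comm _ x) (<.<-respʳ-≈ (+-comm _ x) (+-monoˡ-< x y<z))

  +-mono-< : ∀ {x y u v} → x < y → u < v → x + u < y + v
  +-mono-< {u = u} x<y u<v = <.trans (+-monoˡ-< u x<y) (x+y<x+z _ u<v)

  x<y+x : ∀ {y} x → 0# < y → x < y + x
  x<y+x x 0<y = <.<-respˡ-≈ (+-identityˡ x) (+-monoˡ-< x 0<y)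

  +-pos : ∀ {x y} → 0# < x → 0# < y → 0# < x + y
  +-pos {y = y} 0<x 0<y = <.trans 0<y (x<y+x y 0<x)

  y-x+x≈y : ∀ x y → (y - x) + x ≈ y
  y-x+x≈y x y = trans (+-assoc y (- x) x) (trans (+-congˡ (-‿inverseˡ x)) (+-identityʳ y))

  -‿anti-< : ∀ {x y} → x < y → - y < - x
  -‿anti-< {x} {y} x<y = <.<-respʳ-≈
    (trans (+-congʳ (+-comm y (- x))) (trans (+-assoc (- x) y (- y))
      (trans (+-congˡ (-‿inverseʳ y)) (+-identityʳ (- x)))))
    (x<y+x (- y) (x<y⇒0<y-x x<y))

  0<-x : ∀ {x} → x < 0# → 0# < - x
  0<-x x<0 = <.<-respˡ-≈ -0#≈0# (-‿anti-< x<0)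

  0<1 : 0# < 1#
  0<1 with #⇒<∨> 1#0
  ... | inj₂ 0<1 = 0<1
  -- If `1# < 0#`, then `- 1#` is positive and so is its square, which is `1#`.
  ... | inj₁ 1<0 = <.<-respʳ-≈ -1*-1≈1 (*-pos (0<-x 1<0) (0<-x 1<0))
    where
    -1*-1≈1 : - 1# * - 1# ≈ 1#
    -1*-1≈1 = trans (sym (-‿distribˡ-* 1# (- 1#)))
      (trans (-‿cong (*-identityˡ (- 1#))) (-‿involutive 1#))

  ⁻¹-pos : ∀ {x} (0<x : 0# < x) (x#0 : x # 0#) → 0# < x ⁻¹[ x#0 ]
  ⁻¹-pos {x} 0<x x#0 with #⇒<∨> (⁻¹#0 x x#0)
  ... | inj₂ 0<x⁻¹ = 0<x⁻¹
  -- Multiplying a negative inverse by `x` would give `1# < 0#`.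
  ... | inj₁ x⁻¹<0 with () ← <.irrefl refl (<.trans 0<1 (<.<-respˡ-≈ (⁻¹-inverseʳ x x#0)
    (<.<-respʳ-≈ (zeroʳ x) (*-monoˡ-< 0<x x⁻¹<0))))

  half : ∀ {x} → 0# < x → ∃[ y ] (0# < y × y + y ≈ x)
  half {x} 0<x = x * ½ , *-pos 0<x (⁻¹-pos 0<2 2#0) , ½x+½x≈x
    where
    open ≈-Reasoning setoid
    0<2 = +-pos 0<1 0<1
    2#0 = #-sym (<⇒# 0<2)
    ½ = (1# + 1#) ⁻¹[ 2#0 ]
    ½x+½x≈x : x * ½ + x * ½ ≈ x
    ½x+½x≈x = begin
      x * ½ + x * ½                    ≈⟨ distribˡ x ½ ½ ⟨
      x * (½ + ½)                      ≈⟨ *-congˡ (+-cong (*-identityˡ ½) (*-identityˡ ½)) ⟨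
      x * (1# * ½ + 1# * ½)            ≈⟨ *-congˡ (distribʳ ½ 1# 1#) ⟨
      x * ((1# + 1#) * ½)              ≈⟨ *-congˡ (⁻¹-inverseʳ _ 2#0) ⟩
      x * 1#                           ≈⟨ *-identityʳ x ⟩
      x                                ∎

  -- With `ε` half the gap, a late term `s N` satisfies both `L - s N < ε` and `s N - K < ε`; adding
  -- these gives `L - K < L - K`.
  ¬lim<lim : ∀ {s K L} → s ⟶ K → s ⟶ L → ¬ K < L
  ¬lim<lim {s} {K} {L} s⟶K s⟶L K<L with half (x<y⇒0<y-x K<L)
  ... | ε , 0<ε , ε+ε≈L-K with s⟶K ε 0<ε | s⟶L ε 0<ε
  ... | N₁ , near-K | N₂ , near-L = <.irrefl L-K≈sum
    (<.<-respʳ-≈ ε+ε≈L-K (+-mono-< L-s<ε (proj₂ (near-K N (ℕ.m≤m+n N₁ N₂)))))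
    where
    N = N₁ ℕ.+ N₂
    L-s<ε : L - s N < ε
    L-s<ε = <.<-respˡ-≈ (⁻¹-anti-homo‿- (s N) L) (<.<-respʳ-≈ (-‿involutive ε)
      (-‿anti-< (proj₁ (near-L N (ℕ.m≤n+m N₂ N₁)))))
    L-K≈sum : (L - s N) + (s N - K) ≈ L - K
    L-K≈sum = trans (sym (+-assoc (L - s N) (s N) (- K))) (+-congʳ (y-x+x≈y (s N) L))

  -- The order is not decidable, so equality comes from tightness of apartness once both strict
  -- inequalities are refuted.
  ⟶-unique : ∀ {s K L} → s ⟶ K → s ⟶ L → K ≈ L
  ⟶-unique {s} {K} {L} s⟶K s⟶L = proj₁ (tight K L) ¬K#L
    where
    ¬K#L : ¬ K # L
    ¬K#L K#L with #⇒<∨> K#L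
    ... | inj₁ K<L = ¬lim<lim s⟶K s⟶L K<L
    ... | inj₂ L<K = ¬lim<lim s⟶L s⟶K L<K

  infix 4 ∣_∣<_
  -- Chosen so that `∣ x - y ∣< ε` is definitionally `Within ε x y`.
  ∣_∣<_ : Carrier → Carrier → Set ℓ₂
  ∣ x ∣< M = - M < x × x < M

  ∣∣<-resp-≈ : ∀ {x y M} → x ≈ y → ∣ x ∣< M → ∣ y ∣< M
  ∣∣<-resp-≈ x≈y (-M<x , x<M) = <.<-respʳ-≈ x≈y -M<x , <.<-respˡ-≈ x≈y x<M

  ∣-x∣<M : ∀ {x M} → ∣ x ∣< M → ∣ - x ∣< M
  ∣-x∣<M (-M<x , x<M) = -‿anti-< x<M , <.<-respʳ-≈ (-‿involutive _) (-‿anti-< -M<x)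

  ∣x+y∣<M+N : ∀ {x y M N} → ∣ x ∣< M → ∣ y ∣< N → ∣ x + y ∣< M + N
  ∣x+y∣<M+N (-M<x , x<M) (-N<y , y<N) =
    <.<-respˡ-≈ (-‿+-comm _ _) (+-mono-< -M<x -N<y) , +-mono-< x<M y<N

  ∣zx∣<zM : ∀ {x z M} → 0# < z → ∣ x ∣< M → ∣ z * x ∣< z * M
  ∣zx∣<zM 0<z (-M<x , x<M) =
    <.<-respˡ-≈ (sym (-‿distribʳ-* _ _)) (*-monoˡ-< 0<z -M<x) , *-monoˡ-< 0<z x<M

  ∣x∣<-trans : ∀ {x M N} → ∣ x ∣< M → M < N → ∣ x ∣< N
  ∣x∣<-trans (-M<x , x<M) M<N = <.trans (-‿anti-< M<N) -M<x , <.trans x<M M<N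

  0<[1+n]x : ∀ n {x} → 0# < x → 0# < suc n · x
  0<[1+n]x zero    {x} 0<x = <.<-respʳ-≈ (sym (+-identityʳ x)) 0<x
  0<[1+n]x (suc n) 0<x = +-pos 0<x (0<[1+n]x n 0<x)

  x<n⇒x<m+n : ∀ m {n x} → x < n · 1# → x < (m ℕ.+ n) · 1#
  x<n⇒x<m+n zero    x<n = x<n
  x<n⇒x<m+n (suc m) x<n = <.trans (x<n⇒x<m+n m x<n) (x<y+x _ 0<1)

  ∣∣-bounded : ∀ x → ∃[ M ] (0# < M × ∣ x ∣< M)
  ∣∣-bounded x with archimedean x | archimedean (- x)
  -- The sum dominates both Archimedean bounds, and the extra `suc` makes the bound visibly
  -- positive.
  ... | m , x<m | n , -x<n = suc (n ℕ.+ m) · 1# , 0<[1+n]x (n ℕ.+ m) 0<1 ,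
    <.<-respʳ-≈ (-‿involutive x) (-‿anti-<
      (≡.subst (λ k → - x < k · 1#) (≡.cong suc (ℕ.+-comm m n)) (x<n⇒x<m+n (suc m) -x<n))) ,
    x<n⇒x<m+n (suc n) x<m

  Bounded : (ℕ → Carrier) → Set (c ⊔ ℓ₂)
  Bounded u = ∃[ M ] (0# < M × ∀ n → ∣ u n ∣< M)

-- Powers of `q` tend to zero; series with geometrically small remainders.

module GeometricConvergence {c ℓ₁ ℓ₂} (ℝ : RealNumbers c ℓ₁ ℓ₂)
  (q : RealNumbers.Carrier ℝ)
  (0<q : RealNumbers._<_ ℝ (RealNumbers.0# ℝ) q)
  (q<1 : RealNumbers._<_ ℝ q (RealNumbers.1# ℝ)) where
  open RealNumbers ℝ hiding (zero)
  open OrderProperties ℝ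
  open RingProperties ring using (-‿+-comm)
  open ExpProperties (CommutativeRing.commutativeSemiring commutativeRing)
    using (^-homo-*; ^-assocʳ; ^-congʳ)
  open MultProperties semiring using (×-congʳ; ×-comm-*)
  open SumProperties semiring
    using (sum-cong-≋; sum-replicate-zero; ∑-distrib-+; *-distribˡ-sum)
  open SemiringSolver (CommutativeRing.commutativeSemiring commutativeRing)
    using (solve; con; _:+_; _:*_; _:=_)
  open ≈-Reasoning setoid

  private
    d : Carrier
    d = 1# - q

    0<d : 0# < d
    0<d = x<y⇒0<y-x q<1

    1≈q+d : 1# ≈ q + d
    1≈q+d = trans (sym (y-x+x≈y q 1#)) (+-comm d q)

  q^n>0 : ∀ n → 0# < q ^ n
  q^n>0 zero    = 0<1
  q^n>0 (suc n) = *-pos 0<q (q^n>0 n)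

  -- One step of Bernoulli's inequality: since `q + d` is `1#`, the two sides differ by exactly
  -- `d * (suc n · d)`, which is positive.
  q[1+[1+n]d]<1+nd : ∀ n → q * (1# + suc n · d) < 1# + n · d
  q[1+[1+n]d]<1+nd n = <.<-respʳ-≈ eq
    (x<y+x (q * (1# + suc n · d)) (*-pos 0<d (0<[1+n]x n 0<d)))
    where
    eq : d * (suc n · d) + q * (1# + suc n · d) ≈ 1# + n · d
    eq = begin
      d * (suc n · d) + q * (1# + suc n · d)
        ≈⟨ solve 3 (λ q d e → d :* (d :+ e) :+ q :* (con 1 :+ (d :+ e))
             := q :+ (q :+ d) :* d :+ (q :+ d) :* e) refl q d (n · d) ⟩
      q + (q + d) * d + (q + d) * (n · d)
        ≈⟨ +-cong (+-congˡ (*-congʳ 1≈q+d)) (*-congʳ 1≈q+d) ⟨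
      q + 1# * d + 1# * (n · d)
        ≈⟨ +-cong (+-congˡ (*-identityˡ d)) (*-identityˡ (n · d)) ⟩
      q + d + n · d  ≈⟨ +-congʳ 1≈q+d ⟨
      1# + n · d     ∎

  -- The sequence `q ^ n * (1# + n · d)` starts at `1#` and decreases strictly by the previous step,
  -- hence the successor index.
  q^[1+n]*[1+[1+n]d]<1 : ∀ n → q ^ suc n * (1# + suc n · d) < 1#
  q^[1+n]*[1+[1+n]d]<1 n = <.<-respˡ-≈ (rearrange n) (step n)
    where
    rearrange : ∀ n → q ^ n * (q * (1# + suc n · d)) ≈ q ^ suc n * (1# + suc n · d)
    rearrange n = trans (sym (*-assoc (q ^ n) q _)) (*-congʳ (*-comm (q ^ n) q))
    step : ∀ n → q ^ n * (q * (1# + suc n · d)) < 1#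
    step zero    = <.<-respˡ-≈ (sym (*-identityˡ _))
      (<.<-respʳ-≈ (+-identityʳ 1#) (q[1+[1+n]d]<1+nd 0))
    step (suc n) = <.trans (*-monoˡ-< (q^n>0 (suc n)) (q[1+[1+n]d]<1+nd (suc n)))
      (<.<-respˡ-≈ (rearrange n) (step n))

  q^n*M<ε : ∀ {M ε} → 0# < M → 0# < ε → ∃[ n ] q ^ n * M < ε
  -- An integer above `M / (ε d)` makes `M` smaller than `ε * (suc n · d)`, and Bernoulli's
  -- inequality bounds `q ^ suc n * (suc n · d)` by `1#`.
  q^n*M<ε {M} {ε} 0<M 0<ε with archimedean (M * (ε * d) ⁻¹[ #-sym (<⇒# (*-pos 0<ε 0<d)) ])
  ... | n , M/εd<n = suc n ,
    <.trans (*-monoˡ-< (q^n>0 (suc n)) M<ε*[1+n]d)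
      (<.<-respˡ-≈ (trans (sym (*-assoc ε _ _)) (trans (*-congʳ (*-comm ε _)) (*-assoc _ ε _)))
        (<.<-respʳ-≈ (*-identityʳ ε) (*-monoˡ-< 0<ε q^[1+n]*[1+n]d<1)))
    where
    εd#0 = #-sym (<⇒# (*-pos 0<ε 0<d))
    q^[1+n]*[1+n]d<1 : q ^ suc n * (suc n · d) < 1#
    q^[1+n]*[1+n]d<1 =
      <.trans (*-monoˡ-< (q^n>0 (suc n)) (x<y+x (suc n · d) 0<1)) (q^[1+n]*[1+[1+n]d]<1 n)
    M<ε*[1+n]d : M < ε * (suc n · d)
    M<ε*[1+n]d = <.<-respˡ-≈ lhs (<.<-respʳ-≈ rhs
      (*-monoˡ-< (*-pos 0<ε 0<d) (<.trans M/εd<n (x<y+x (n · 1#) 0<1))))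
      where
      lhs : ε * d * (M * (ε * d) ⁻¹[ εd#0 ]) ≈ M
      lhs = begin
        ε * d * (M * (ε * d) ⁻¹[ εd#0 ])  ≈⟨ *-comm _ _ ⟩
        M * (ε * d) ⁻¹[ εd#0 ] * (ε * d)  ≈⟨ *-assoc M _ _ ⟩
        M * ((ε * d) ⁻¹[ εd#0 ] * (ε * d))
                                          ≈⟨ *-congˡ (⁻¹-inverseˡ (ε * d) εd#0) ⟩
        M * 1#                            ≈⟨ *-identityʳ M ⟩
        M                                 ∎
      rhs : ε * d * (suc n · 1#) ≈ ε * (suc n · d)
      rhs = begin
        ε * d * (suc n · 1#)   ≈⟨ *-assoc ε d _ ⟩
        ε * (d * (suc n · 1#)) ≈⟨ *-congˡ (×-comm-* (suc n) d 1#) ⟩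
        ε * (suc n · (d * 1#)) ≈⟨ *-congˡ (×-congʳ (suc n) (*-identityʳ d)) ⟩
        ε * (suc n · d)        ∎

  ∣q^n*x∣<M : ∀ n {x M} → 0# < M → ∣ x ∣< M → ∣ q ^ n * x ∣< M
  ∣q^n*x∣<M zero    0<M ∣x∣<M = ∣∣<-resp-≈ (sym (*-identityˡ _)) ∣x∣<M
  ∣q^n*x∣<M (suc n) {x} {M} 0<M ∣x∣<M = ∣∣<-resp-≈ (sym (*-assoc q (q ^ n) x))
    (∣x∣<-trans (∣zx∣<zM 0<q (∣q^n*x∣<M n 0<M ∣x∣<M)) qM<M)
    where
    qM<M : q * M < M
    qM<M = <.<-respˡ-≈ (*-comm M q) (<.<-respʳ-≈ (*-identityʳ M) (*-monoˡ-< 0<M q<1))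

  -- Convergence with an exact remainder. Remainders and their bounds simply add, so finite sums of
  -- series need no splitting of `ε`, which enters only in `GeometricSum⇒⟶`.
  GeometricSum : (ℕ → Carrier) → Carrier → Set (c ⊔ ℓ₁ ⊔ ℓ₂)
  GeometricSum u L =
    ∃[ R ] (Bounded R × ∀ N → ∑[ a < N ] u (toℕ a) + q ^ N * R N ≈ L)

  GeometricSum⇒⟶ : ∀ u {L} → GeometricSum u L → (λ N → ∑[ a < N ] u (toℕ a)) ⟶ L
  GeometricSum⇒⟶ u {L} (R , (M , 0<M , ∣R∣<M) , remainder) ε 0<ε with q^n*M<ε 0<M 0<ε
  ... | N , q^N*M<ε = N , within
    where
    within : ∀ n → N ℕ.≤ n → Within ε (∑[ a < n ] u (toℕ a)) L
    within n N≤n = ∣∣<-resp-≈ -q^nR≈S-L (∣-x∣<M (∣∣<-resp-≈ split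
      -- The factor `q ^ N` already brings the remainder below `ε`; the remaining `q ^ (n ∸ N)`
      -- preserves that bound.
      (∣q^n*x∣<M (n ∸ N) 0<ε (∣x∣<-trans (∣zx∣<zM (q^n>0 N) (∣R∣<M n)) q^N*M<ε))))
      where
      S = ∑[ a < n ] u (toℕ a)
      split : q ^ (n ∸ N) * (q ^ N * R n) ≈ q ^ n * R n
      split = begin
        q ^ (n ∸ N) * (q ^ N * R n)  ≈⟨ *-assoc _ _ _ ⟨
        q ^ (n ∸ N) * q ^ N * R n    ≈⟨ *-congʳ (^-homo-* q (n ∸ N) N) ⟨
        q ^ (n ∸ N ℕ.+ N) * R n      ≡⟨ ≡.cong (λ k → q ^ k * R n) (ℕ.m∸n+n≡m N≤n) ⟩
        q ^ n * R n                  ∎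
      -q^nR≈S-L : - (q ^ n * R n) ≈ S - L
      -q^nR≈S-L = begin
        - (q ^ n * R n)              ≈⟨ +-identityˡ _ ⟨
        0# - q ^ n * R n             ≈⟨ +-congʳ (-‿inverseʳ S) ⟨
        S - S - q ^ n * R n          ≈⟨ +-assoc S (- S) _ ⟩
        S + (- S - q ^ n * R n)      ≈⟨ +-congˡ (-‿+-comm S _) ⟩
        S - (S + q ^ n * R n)        ≈⟨ +-congˡ (-‿cong (remainder n)) ⟩
        S - L                        ∎

  GeometricSum-cong : ∀ {u v K L} → (∀ a → u a ≈ v a) → K ≈ L →
                      GeometricSum u K → GeometricSum v L
  GeometricSum-cong u≈v K≈L (R , R-bounded , remainder) = R , R-bounded , λ N →
    trans (+-congʳ (sum-cong-≋ {N} λ a → sym (u≈v (toℕ a)))) (trans (remainder N) K≈L)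

  GeometricSum-0 : GeometricSum (λ _ → 0#) 0#
  GeometricSum-0 = (λ _ → 0#) , (1# , 0<1 , λ _ → ∣0∣<1) , λ N →
    trans (+-cong (sum-replicate-zero N) (zeroʳ (q ^ N))) (+-identityʳ 0#)
    where
    ∣0∣<1 : ∣ 0# ∣< 1#
    ∣0∣<1 = <.<-respʳ-≈ (-‿inverseʳ 1#) (x<y+x (- 1#) 0<1) , 0<1

  GeometricSum-+ : ∀ u v {K L} → GeometricSum u K → GeometricSum v L →
                   GeometricSum (λ a → u a + v a) (K + L)
  GeometricSum-+ u v {K} {L} (R , (M , 0<M , ∣R∣<M) , R-rem)
    (R′ , (M′ , 0<M′ , ∣R′∣<M′) , R′-rem) =
    (λ N → R N + R′ N) ,
    (M + M′ , +-pos 0<M 0<M′ , λ N → ∣x+y∣<M+N (∣R∣<M N) (∣R′∣<M′ N)) ,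
    λ N → begin
      ∑[ a < N ] (u (toℕ a) + v (toℕ a)) + q ^ N * (R N + R′ N)
        ≈⟨ +-congʳ (∑-distrib-+ {N} (u ∘ toℕ) (v ∘ toℕ)) ⟩
      (∑[ a < N ] u (toℕ a)) + (∑[ a < N ] v (toℕ a)) + q ^ N * (R N + R′ N)
        ≈⟨ solve 5 (λ s t z r r′ → s :+ t :+ z :* (r :+ r′) := (s :+ z :* r) :+ (t :+ z :* r′))
             refl (∑[ a < N ] u (toℕ a)) (∑[ a < N ] v (toℕ a)) (q ^ N) (R N) (R′ N) ⟩
      ((∑[ a < N ] u (toℕ a)) + q ^ N * R N) + ((∑[ a < N ] v (toℕ a)) + q ^ N * R′ N)
        ≈⟨ +-cong (R-rem N) (R′-rem N) ⟩
      K + L  ∎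

  GeometricSum-∑ : ∀ {m} (u : Fin m → ℕ → Carrier) {L : Fin m → Carrier} →
                   (∀ i → GeometricSum (u i) (L i)) →
                   GeometricSum (λ a → ∑[ i < m ] u i a) (∑[ i < m ] L i)
  GeometricSum-∑ {zero}  u _    = GeometricSum-0
  GeometricSum-∑ {suc m} u sums =
    GeometricSum-+ (u zero) (λ a → ∑[ i < m ] u (suc i) a)
      (sums zero) (GeometricSum-∑ (u ∘ suc) (sums ∘ suc))

  -- The hypothesis says that `g` is `1/(1 − z)`, stated without division; unfolding it repeatedly
  -- produces the partial sums.
  geometric-remainder : ∀ {g z} → 1# + z * g ≈ g → ∀ N →
                        ∑[ a < N ] (z ^ toℕ a) + z ^ N * g ≈ g
  geometric-remainder {g} {z} 1+zg≈g zero    = trans (+-identityˡ _) (*-identityˡ g)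
  geometric-remainder {g} {z} 1+zg≈g (suc N) = begin
    1# + (∑[ a < N ] (z * z ^ toℕ a)) + z * z ^ N * g
      ≈⟨ +-congʳ (+-congˡ (*-distribˡ-sum {N} z (λ a → z ^ toℕ a))) ⟨
    1# + z * (∑[ a < N ] (z ^ toℕ a)) + z * z ^ N * g
      ≈⟨ solve 4 (λ z s w g → con 1 :+ z :* s :+ z :* w :* g := con 1 :+ z :* (s :+ w :* g))
           refl z (∑[ a < N ] (z ^ toℕ a)) (z ^ N) g ⟩
    1# + z * (∑[ a < N ] (z ^ toℕ a) + z ^ N * g)
      ≈⟨ +-congˡ (*-congˡ (geometric-remainder 1+zg≈g N)) ⟩
    1# + z * g  ≈⟨ 1+zg≈g ⟩
    g           ∎

  [q^k]^n≈[q^n]^k : ∀ k n → (q ^ k) ^ n ≈ (q ^ n) ^ k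
  [q^k]^n≈[q^n]^k k n = trans (^-assocʳ q k n)
    (trans (^-congʳ q (ℕ.*-comm k n)) (sym (^-assocʳ q n k)))

  -- The Jackson weight `q ^ a` raises the exponent by one, so the terms are geometric with ratio
  -- `q ^ suc k`.
  monomial : ∀ c k {g} → 1# + q ^ suc k * g ≈ g →
             GeometricSum (λ a → c * (q ^ a) ^ k * q ^ a) (c * g)
  monomial c k {g} 1+zg≈g with ∣∣-bounded (c * g)
  ... | M , 0<M , ∣cg∣<M =
    -- The geometric remainder `c * (z ^ N * g)` with one factor `q ^ N` taken out of `z ^ N`.
    (λ N → (q ^ N) ^ k * (c * g)) ,
    (M , 0<M , λ N → ∣∣<-resp-≈ (*-congʳ (sym (^-assocʳ q N k)))
      (∣q^n*x∣<M (N ℕ.* k) 0<M ∣cg∣<M)) ,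
    λ N → begin
      ∑[ a < N ] (c * (q ^ toℕ a) ^ k * q ^ toℕ a) + q ^ N * ((q ^ N) ^ k * (c * g))
        ≈⟨ +-cong (trans (sum-cong-≋ {N} (term ∘ toℕ))
             (sym (*-distribˡ-sum {N} c (λ a → z ^ toℕ a)))) (tail N) ⟩
      c * (∑[ a < N ] (z ^ toℕ a)) + c * (z ^ N * g)
        ≈⟨ distribˡ c _ _ ⟨
      c * (∑[ a < N ] (z ^ toℕ a) + z ^ N * g)
        ≈⟨ *-congˡ (geometric-remainder 1+zg≈g N) ⟩
      c * g  ∎
    where
    z = q ^ suc k
    z^a : ∀ a → (q ^ a) ^ suc k ≈ z ^ a
    z^a a = [q^k]^n≈[q^n]^k a (suc k)
    term : ∀ a → c * (q ^ a) ^ k * q ^ a ≈ c * z ^ a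
    term a = trans (*-assoc c _ _) (*-congˡ (trans (*-comm _ _) (z^a a)))
    tail : ∀ N → q ^ N * ((q ^ N) ^ k * (c * g)) ≈ c * (z ^ N * g)
    tail N = begin
      q ^ N * ((q ^ N) ^ k * (c * g))
        ≈⟨ solve 4 (λ w v c g → w :* (v :* (c :* g)) := c :* (w :* v :* g))
             refl (q ^ N) ((q ^ N) ^ k) c g ⟩
      c * ((q ^ N) ^ suc k * g)  ≈⟨ *-congˡ (*-congʳ (z^a N)) ⟩
      c * (z ^ N * g)            ∎

-- Generating functions and Jackson integrals of the q-Bernoulli polynomials.

module QBernoulliProperties {c ℓ₁ ℓ₂} (ℝ : RealNumbers c ℓ₁ ℓ₂)
  (q : RealNumbers.Carrier ℝ)
  (0<q : RealNumbers._<_ ℝ (RealNumbers.0# ℝ) q)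
  (q<1 : RealNumbers._<_ ℝ q (RealNumbers.1# ℝ)) where
  open RealNumbers ℝ hiding (zero)
  open PowerSeries ℝ
  open PowerSeriesProperties ℝ
  open OrderProperties ℝ
  open QBernoulli ℝ q 0<q q<1
  open GeometricConvergence ℝ q 0<q q<1
  open SumProperties semiring using (sum-cong-≋; *-distribˡ-sum; *-distribʳ-sum)
  open SemiringSolver (CommutativeRing.commutativeSemiring commutativeRing)
    using (solve; _:+_; _:*_; _:=_)
  open ≈-Reasoning setoid

  [n]q!*expq : ∀ n → [ n ]q! * expq n ≈ 1#
  [n]q!*expq n = ⁻¹-inverseʳ [ n ]q! ([n]q!#0 n)

  -- By definition `t/[expq-1]` is the reciprocal of `shift (expq ⊖ 1ₛ)`, so one factor cancels.
  T^[1+r]⊛shift : ∀ r → t/[expq-1] ^ₛ suc r ⊛ shift (expq ⊖ 1ₛ) ≋ t/[expq-1] ^ₛ r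
  T^[1+r]⊛shift r n = begin
    ((T ⊛ T^r) ⊛ S) n  ≈⟨ ⊛-comm (T ⊛ T^r) S n ⟩
    (S ⊛ (T ⊛ T^r)) n  ≈⟨ ⊛-assoc S T T^r n ⟨
    ((S ⊛ T) ⊛ T^r) n  ≈⟨ ⊛-congʳ T^r (recip-inverse S shift[expq-1]₀#0) n ⟩
    (1ₛ ⊛ T^r) n       ≈⟨ ⊛-identityˡ T^r n ⟩
    T^r n              ∎
    where
    T = t/[expq-1]
    T^r = T ^ₛ r
    S = shift (expq ⊖ 1ₛ)

  -- For `f = expq ⟦ x t⟧` the left factor generates `B k x`; placing it first attaches the
  -- summation index to it.
  T^[1+r]⊛f : ∀ r f → t/[expq-1] ^ₛ suc r ⊛ f ≋ (t/[expq-1] ⊛ f) ⊛ t/[expq-1] ^ₛ r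
  T^[1+r]⊛f r f n = begin
    ((T ⊛ T^r) ⊛ f) n  ≈⟨ ⊛-assoc T T^r f n ⟩
    (T ⊛ (T^r ⊛ f)) n  ≈⟨ ⊛-congˡ T (⊛-comm T^r f) n ⟩
    (T ⊛ (f ⊛ T^r)) n  ≈⟨ ⊛-assoc T f T^r n ⟨
    ((T ⊛ f) ⊛ T^r) n  ∎
    where
    T = t/[expq-1]
    T^r = T ^ₛ r

  expq⟦0t⟧ : expq ⟦ 0# t⟧ ≋ 1ₛ
  expq⟦0t⟧ zero    = trans (*-identityʳ (expq 0)) (1⁻¹≈1 1# ([n]q!#0 0) refl)
  expq⟦0t⟧ (suc n) = trans (*-congˡ (zeroˡ (0# ^ n))) (zeroʳ (expq (suc n)))

  B⟨r⟩[0] : ∀ r n → B⟨ r ⟩ n 0# ≈ [ n ]q! * (t/[expq-1] ^ₛ r) n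
  B⟨r⟩[0] r n = *-congˡ (trans
    (⊛-congˡ (t/[expq-1] ^ₛ r) expq⟦0t⟧ n) (⊛-identityʳ (t/[expq-1] ^ₛ r) n))

  [1-q]⁻¹ : Carrier
  [1-q]⁻¹ = (1# - q) ⁻¹[ 1-q#0 ]

  -- The value 1/(1 − q^(k+1)) of ∑ₐ q^((k+1)a), written as [k]!/((1 − q) [k+1]!) so that
  -- (1 − q) * expq k * geometricValue k collapses to expq (k+1).
  geometricValue : ℕ → Carrier
  geometricValue k = [1-q]⁻¹ * [ k ]q! * expq (suc k)

  geometricValue-fixed : ∀ k → 1# + q ^ suc k * geometricValue k ≈ geometricValue k
  geometricValue-fixed k = begin
    -- Here `1#` is written as `[ suc k ]q! * expq (suc k)`, whose factorial unfolds definitionally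
    -- to `(1# - z) * [1-q]⁻¹ * [ k ]q!`.
    1# + z * g                  ≈⟨ +-congʳ ([n]q!*expq (suc k)) ⟨
    (1# - z) * [1-q]⁻¹ * [ k ]q! * expq (suc k) + z * g
      ≈⟨ solve 5 (λ y z w f e → y :* w :* f :* e :+ z :* (w :* f :* e) := (y :+ z) :* (w :* f :* e))
           refl (1# - z) z [1-q]⁻¹ [ k ]q! (expq (suc k)) ⟩
    (1# - z + z) * g            ≈⟨ *-congʳ (y-x+x≈y z 1#) ⟩
    1# * g                      ≈⟨ *-identityˡ g ⟩
    g                           ∎
    where
    z = q ^ suc k
    g = geometricValue k

  module _ (r m : ℕ) where
    private
      T^r : FPS
      T^r = t/[expq-1] ^ₛ r

      -- The coefficient of `y ^ (m ∸ i)` in `B⟨ r ⟩ m y`: the index follows the factor `T^r`, not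
      -- the degree.
      coeff : ℕ → Carrier
      coeff i = [ m ]q! * T^r i * expq (m ∸ i)

    jacksonSum : Carrier
    jacksonSum = ∑[ i ≤ m ] (coeff (toℕ i) * geometricValue (m ∸ toℕ i))

    jacksonSum-geometric : GeometricSum (λ a → B⟨ r ⟩ m (q ^ a) * q ^ a) jacksonSum
    jacksonSum-geometric = GeometricSum-cong polynomial refl
      (GeometricSum-∑ {suc m} (λ i a → coeff (toℕ i) * (q ^ a) ^ (m ∸ toℕ i) * q ^ a) λ i →
        monomial (coeff (toℕ i)) (m ∸ toℕ i) (geometricValue-fixed (m ∸ toℕ i)))
      where
      polynomial : ∀ a → ∑[ i ≤ m ] (coeff (toℕ i) * (q ^ a) ^ (m ∸ toℕ i) * q ^ a) ≈
                         B⟨ r ⟩ m (q ^ a) * q ^ a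
      polynomial a = begin
        ∑[ i ≤ m ] (coeff (toℕ i) * (q ^ a) ^ (m ∸ toℕ i) * q ^ a)
          ≈⟨ *-distribʳ-sum {suc m} (q ^ a) (λ i → coeff (toℕ i) * (q ^ a) ^ (m ∸ toℕ i)) ⟨
        (∑[ i ≤ m ] (coeff (toℕ i) * (q ^ a) ^ (m ∸ toℕ i))) * q ^ a
          ≈⟨ *-congʳ (sum-cong-≋ {suc m} (λ i → solve 4
               (λ f p e x → f :* p :* e :* x := f :* (p :* (e :* x))) refl
               [ m ]q! (T^r (toℕ i)) (expq (m ∸ toℕ i)) ((q ^ a) ^ (m ∸ toℕ i)))) ⟩
        (∑[ i ≤ m ] ([ m ]q! * (T^r (toℕ i) * (expq ⟦ q ^ a t⟧) (m ∸ toℕ i)))) * q ^ a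
          ≈⟨ *-congʳ (*-distribˡ-sum {suc m} [ m ]q!
               (λ i → T^r (toℕ i) * (expq ⟦ q ^ a t⟧) (m ∸ toℕ i))) ⟨
        B⟨ r ⟩ m (q ^ a) * q ^ a  ∎

    -- Integrating `y ^ k` divides `expq k` by `[ suc k ]q`, giving `expq (suc k)`: termwise
    -- integration is a shift of `expq`.
    jacksonSum-value : (1# - q) * jacksonSum ≈ [ m ]q! * (T^r ⊛ shift (expq ⊖ 1ₛ)) m
    jacksonSum-value = begin
      (1# - q) * jacksonSum
        ≈⟨ *-distribˡ-sum {suc m} (1# - q) (λ i → coeff (toℕ i) * geometricValue (m ∸ toℕ i)) ⟩
      ∑[ i ≤ m ] ((1# - q) * (coeff (toℕ i) * geometricValue (m ∸ toℕ i)))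
        ≈⟨ sum-cong-≋ {suc m} (term ∘ toℕ) ⟩
      ∑[ i ≤ m ] ([ m ]q! * (T^r (toℕ i) * shift (expq ⊖ 1ₛ) (m ∸ toℕ i)))
        ≈⟨ *-distribˡ-sum {suc m} [ m ]q! (λ i → T^r (toℕ i) * shift (expq ⊖ 1ₛ) (m ∸ toℕ i)) ⟨
      [ m ]q! * (T^r ⊛ shift (expq ⊖ 1ₛ)) m  ∎
      where
      term : ∀ i → (1# - q) * (coeff i * geometricValue (m ∸ i)) ≈
                   [ m ]q! * (T^r i * shift (expq ⊖ 1ₛ) (m ∸ i))
      term i = begin
        (1# - q) * (coeff i * geometricValue k)
          ≈⟨ solve 7 (λ y w F f p e e′ → y :* (F :* p :* e :* (w :* f :* e′))
               := (y :* w) :* ((f :* e) :* (F :* (p :* e′)))) refl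
               (1# - q) [1-q]⁻¹ [ m ]q! [ k ]q! (T^r i) (expq k) (expq (suc k)) ⟩
        (1# - q) * [1-q]⁻¹ * ([ k ]q! * expq k * ([ m ]q! * (T^r i * expq (suc k))))
          ≈⟨ *-cong (⁻¹-inverseʳ (1# - q) 1-q#0) (*-congʳ ([n]q!*expq k)) ⟩
        1# * (1# * ([ m ]q! * (T^r i * expq (suc k))))
          ≈⟨ trans (*-identityˡ _) (*-identityˡ _) ⟩
        [ m ]q! * (T^r i * expq (suc k))
          ≈⟨ *-congˡ (*-congˡ (x-0≈x (expq (suc k)))) ⟨
        [ m ]q! * (T^r i * shift (expq ⊖ 1ₛ) k)  ∎
        where k = m ∸ i

    B-integrable : JacksonIntegrable (B⟨ r ⟩ m)
    B-integrable = jacksonSum , GeometricSum⇒⟶ (λ a → B⟨ r ⟩ m (q ^ a) * q ^ a) jacksonSum-geometric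

  -- The limit carried by `int` is arbitrary, so uniqueness of limits first identifies it with
  -- `jacksonSum`; cancelling one factor of the generating series then lowers the order.
  ∫B : ∀ r m (int : JacksonIntegrable (B⟨ suc r ⟩ m)) → ∫₀¹ (B⟨ suc r ⟩ m) int ≈ B⟨ r ⟩ m 0#
  ∫B r m (S , partial⟶S) = begin
    (1# - q) * S                        ≈⟨ *-congˡ S≈jacksonSum ⟩
    (1# - q) * jacksonSum (suc r) m     ≈⟨ jacksonSum-value (suc r) m ⟩
    [ m ]q! * (t/[expq-1] ^ₛ suc r ⊛ shift (expq ⊖ 1ₛ)) m
                                        ≈⟨ *-congˡ (T^[1+r]⊛shift r m) ⟩
    [ m ]q! * (t/[expq-1] ^ₛ r) m       ≈⟨ B⟨r⟩[0] r m ⟨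
    B⟨ r ⟩ m 0#                         ∎
    where
    S≈jacksonSum : S ≈ jacksonSum (suc r) m
    S≈jacksonSum = ⟶-unique partial⟶S (proj₂ (B-integrable (suc r) m))

  -- From Cauchy products to q-binomial convolutions.

  binom-cancel : ∀ n k u v → binom n k * ([ n ∸ k ]q! * u) * ([ k ]q! * v) ≈ [ n ]q! * (v * u)
  binom-cancel n k u v = begin
    [ n ]q! * i * ([ n ∸ k ]q! * u) * ([ k ]q! * v)
      ≈⟨ solve 6 (λ F i f g u v → F :* i :* (f :* u) :* (g :* v) := (i :* (g :* f)) :* (F :* (v :* u)))
           refl [ n ]q! i [ n ∸ k ]q! [ k ]q! u v ⟩
    i * ([ k ]q! * [ n ∸ k ]q!) * ([ n ]q! * (v * u))
      ≈⟨ *-congʳ (⁻¹-inverseˡ _ kl#0) ⟩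
    1# * ([ n ]q! * (v * u))
      ≈⟨ *-identityˡ _ ⟩
    [ n ]q! * (v * u)  ∎
    where
    kl#0 = x#0y#0→xy#0 ([n]q!#0 k) ([n]q!#0 (n ∸ k))
    i = ([ k ]q! * [ n ∸ k ]q!) ⁻¹[ kl#0 ]

  B-expansion : ∀ r n x → B⟨ suc r ⟩ n x ≈
                ∑[ k ≤ n ] (binom n (toℕ k) * B⟨ r ⟩ (n ∸ toℕ k) 0# * B (toℕ k) x)
  B-expansion r n x = begin
    [ n ]q! * (t/[expq-1] ^ₛ suc r ⊛ expq ⟦ x t⟧) n
      ≈⟨ *-congˡ (T^[1+r]⊛f r (expq ⟦ x t⟧) n) ⟩
    [ n ]q! * (H ⊛ T^r) n
      ≈⟨ *-distribˡ-sum {suc n} [ n ]q! (λ k → H (toℕ k) * T^r (n ∸ toℕ k)) ⟩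
    ∑[ k ≤ n ] ([ n ]q! * (H (toℕ k) * T^r (n ∸ toℕ k)))
      ≈⟨ sum-cong-≋ {suc n} (term ∘ toℕ) ⟩
    ∑[ k ≤ n ] (binom n (toℕ k) * B⟨ r ⟩ (n ∸ toℕ k) 0# * B (toℕ k) x)  ∎
    where
    T^r = t/[expq-1] ^ₛ r
    H = t/[expq-1] ⊛ expq ⟦ x t⟧
    term : ∀ k → [ n ]q! * (H k * T^r (n ∸ k)) ≈ binom n k * B⟨ r ⟩ (n ∸ k) 0# * B k x
    term k = begin
      [ n ]q! * (H k * T^r (n ∸ k))
        ≈⟨ binom-cancel n k (T^r (n ∸ k)) (H k) ⟨
      binom n k * ([ n ∸ k ]q! * T^r (n ∸ k)) * B k x
        ≈⟨ *-congʳ (*-congˡ (B⟨r⟩[0] r (n ∸ k))) ⟨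
      binom n k * B⟨ r ⟩ (n ∸ k) 0# * B k x  ∎

theorem4 : ∀ {c ℓ₁ ℓ₂} (ℝ : RealNumbers c ℓ₁ ℓ₂) →
    let open RealNumbers ℝ in
    (q : Carrier) (0<q : 0# < q) (q<1 : q < 1#) →
    let open QBernoulli ℝ q 0<q q<1 in
    (r : ℕ) → 1 ℕ.≤ r →
    (∀ m → JacksonIntegrable (B⟨ r ⟩ m)) ×
    (∀ (int : ∀ m → JacksonIntegrable (B⟨ r ⟩ m)) →
      (∀ n x →
        (B⟨ r ⟩ n x ≈
          ∑[ k ≤ n ] (binom n (toℕ k) * ∫₀¹ (B⟨ r ⟩ (n ∸ toℕ k)) (int (n ∸ toℕ k)) * B (toℕ k) x)) ×
        (∑[ k ≤ n ] (binom n (toℕ k) * ∫₀¹ (B⟨ r ⟩ (n ∸ toℕ k)) (int (n ∸ toℕ k)) * B (toℕ k) x) ≈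
          ∑[ k ≤ n ] (binom n (toℕ k) * B⟨ r ∸ 1 ⟩ (n ∸ toℕ k) 0# * B (toℕ k) x))) ×
      (∀ m → ∫₀¹ (B⟨ r ⟩ m) (int m) ≈ B⟨ r ∸ 1 ⟩ m 0#))
theorem4 ℝ q 0<q q<1 (suc r) _ = B-integrable (suc r) , λ int →
  (λ n x →
    -- The expansion is known with the numbers of lower order; replacing each by its integral gives
    -- the first form.
    trans (B-expansion r n x) (sym (integrals≈numbers int n x)) ,
    integrals≈numbers int n x) ,
  λ m → ∫B r m (int m)
  where
  open RealNumbers ℝ
  open QBernoulli ℝ q 0<q q<1
  open QBernoulliProperties ℝ q 0<q q<1
  integrals≈numbers : (int : ∀ m → JacksonIntegrable (B⟨ suc r ⟩ m)) → ∀ n x →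
    ∑[ k ≤ n ] (binom n (toℕ k) * ∫₀¹ (B⟨ suc r ⟩ (n ∸ toℕ k)) (int (n ∸ toℕ k)) * B (toℕ k) x) ≈
    ∑[ k ≤ n ] (binom n (toℕ k) * B⟨ r ⟩ (n ∸ toℕ k) 0# * B (toℕ k) x)
  integrals≈numbers int n x = SumProperties.sum-cong-≋ semiring {suc n} λ k →
    *-congʳ {B (toℕ k) x} (*-congˡ {binom n (toℕ k)} (∫B r (n ∸ toℕ k) (int (n ∸ toℕ k))))
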